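{- Let $p$ be a prime. The independence polynomial $I(\varGamma(\mathbb{Z}_{p^3}), x)$ of the zero divisor graph $\varGamma(\mathbb{Z}_{p^3})$ is log-concave and unimodal.
   Context: For a positive integer $n$, the zero divisor graph $\varGamma(\mathbb{Z}_n)$ is the simple undirected graph whose vertices are the non-zero zero divisors of the ring $\mathbb{Z}_n$ of integers modulo $n$ (non-zero $a$ such that $ab=0$ for some non-zero $b$), two distinct vertices $a,b$ being adjacent if and only if $ab=0$ in $\mathbb{Z}_n$. An independent set of a finite graph $G$ is a set of vertices no two of which are adjacent (the empty set included); $\alpha(G)$ is the maximum size of an independent set, and $s_k(G)$ is the number of independent sets of size $k$. The independence polynomial of $G$ is $I(G,x)=\sum_{k=0}^{\alpha(G)} s_k(G)x^k$. A polynomial $\sum_{i=0}^{n}\ell_i x^i$ (of degree $n$) is log-concave if $\ell_j^2\ge \ell_{j-1}\ell_{j+1}$ for all $1\le j\le n-1$; it is unimodal if there is an index $m$, $0\le m\le n$, with $\ell_0\le \ell_1\le\dots\le \ell_m\ge \ell_{m+1}\ge\dots\ge \ell_n$. -}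

module Defs where

open import Data.Empty using (⊥-elim)
open import Data.Fin.Base using (Fin; toℕ)
open import Data.Fin.Properties using (any?) renaming (_≟_ to _≟ᶠ_)
open import Data.Fin.Subset using (Subset; inside; outside; ∣_∣; Lift; ⊥)
open import Data.Fin.Subset.Properties using (Lift?; ∉⊥; ∣⊥∣≡0)
open import Data.List.Base using (List; _++_; [_]; map; filter; length)
open import Data.List.Extrema.Nat using (max; xs≤max; argmax-sel)
open import Data.List.Membership.Propositional using () renaming (_∈_ to _∈ˡ_)
open import Data.List.Membership.Propositional.Properties
  using (∈-map⁺; ∈-map⁻; ∈-++⁺ˡ; ∈-++⁺ʳ; ∈-filter⁺; ∈-filter⁻; ∈-length)
open import Data.List.Properties using (filter-none)
open import Data.List.Relation.Unary.All as All using ([])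
open import Data.List.Relation.Unary.Any using (here)
open import Data.List.Relation.Unary.Unique.Propositional using (Unique; []; _∷_)
open import Data.List.Relation.Unary.Unique.Propositional.Properties using (map⁺; ++⁺)
open import Data.Nat.Base
open import Data.Nat.DivMod using (_mod_)
open import Data.Nat.Properties using (_≟_; *-comm; <⇒≱; >⇒≢)
open import Data.Product.Base using (∃-syntax; _×_; _,_; proj₁)
open import Data.Sum.Base using (inj₁; inj₂)
open import Data.Vec.Base using ([]; _∷_)
open import Data.Vec.Properties using (∷-injectiveʳ)
open import Function.Base using (_∘_; id)
open import Level using (0ℓ)
open import Relation.Binary.Core using (Rel)
open import Relation.Binary.Definitions using (Symmetric; Irreflexive) renaming (Decidable to Decidable₂)
open import Relation.Binary.PropositionalEquality
  using (_≡_; _≢_; refl; sym; trans; cong; subst)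
open import Relation.Nullary using (¬_)
open import Relation.Nullary.Decidable using (¬?; _×-dec_)
open import Relation.Unary using (Pred; Decidable)

-- The nonzero polynomials over ℕ, as finitely supported coefficient sequences.
record Polynomial : Set where
  field
    degree    : ℕ
    coeff     : ℕ → ℕ
    leading≢0 : coeff degree ≢ 0
    bounded   : ∀ k → degree < k → coeff k ≡ 0

module _ (f : Polynomial) where
  open Polynomial f

  -- When degree ≡ 0 the range 1 ≤ j ≤ degree ∸ 1 is empty, as intended.
  LogConcave : Set
  LogConcave = ∀ j → 1 ≤ j → j ≤ degree ∸ 1 →
    coeff j ^ 2 ≥ coeff (j ∸ 1) * coeff (j + 1)

  Unimodal : Set
  Unimodal = ∃[ m ] m ≤ degree
    × (∀ i → i < m → coeff i ≤ coeff (i + 1))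
    × (∀ i → m ≤ i → i < degree → coeff i ≥ coeff (i + 1))

-- A finite simple graph whose vertices are those elements of Fin order
-- that satisfy Vertex; the other elements are not part of the graph.
record FiniteGraph : Set₁ where
  field
    order      : ℕ
    Vertex     : Pred (Fin order) 0ℓ
    Adj        : Rel (Fin order) 0ℓ
    Vertex?    : Decidable Vertex
    Adj?       : Decidable₂ Adj
    adj-vertex : ∀ {a b} → Adj a b → Vertex a × Vertex b
    adj-sym    : Symmetric Adj
    adj-irrefl : Irreflexive _≡_ Adj

subsets : ∀ n → List (Subset n)
subsets zero    = [ [] ]
subsets (suc n) = map (outside ∷_) (subsets n) ++ map (inside ∷_) (subsets n)

-- Every subset is listed, exactly once, so counting in the list counts subsets.
subsets-complete : ∀ {n} (S : Subset n) → S ∈ˡ subsets n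
subsets-complete []            = here refl
subsets-complete (outside ∷ S) = ∈-++⁺ˡ (∈-map⁺ (outside ∷_) (subsets-complete S))
subsets-complete (inside  ∷ S) =
  ∈-++⁺ʳ (map (outside ∷_) (subsets _)) (∈-map⁺ (inside ∷_) (subsets-complete S))

subsets-unique : ∀ n → Unique (subsets n)
subsets-unique zero    = [] ∷ []
subsets-unique (suc n) =
  ++⁺ (map⁺ ∷-injectiveʳ (subsets-unique n)) (map⁺ ∷-injectiveʳ (subsets-unique n)) disjoint
  where
  disjoint : ∀ {S} → ¬ (S ∈ˡ map (outside ∷_) (subsets n) × S ∈ˡ map (inside ∷_) (subsets n))
  disjoint (o , i) with ∈-map⁻ (outside ∷_) o | ∈-map⁻ (inside ∷_) i
  ... | _ , _ , refl | _ , _ , ()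

module _ (G : FiniteGraph) where
  open FiniteGraph G

  Independent : Pred (Subset order) 0ℓ
  Independent S = Lift Vertex S × Lift (λ a → Lift (λ b → ¬ Adj a b) S) S

  independent? : Decidable Independent
  independent? S = Lift? Vertex? S ×-dec Lift? (λ a → Lift? (λ b → ¬? (Adj? a b)) S) S

  independentSets : List (Subset order)
  independentSets = filter independent? (subsets order)

  α : ℕ
  α = max 0 (map ∣_∣ independentSets)

  s : ℕ → ℕ
  s k = length (filter (λ S → ∣ S ∣ ≟ k) independentSets)

  private
    ⊥-independent : Independent ⊥
    ⊥-independent = (λ x∈⊥ → ⊥-elim (∉⊥ x∈⊥)) , (λ x∈⊥ → ⊥-elim (∉⊥ x∈⊥))

    α-attained : ∃[ S ] S ∈ˡ independentSets × ∣ S ∣ ≡ α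
    α-attained with argmax-sel id 0 (map ∣_∣ independentSets)
    ... | inj₁ α≡0 = ⊥ , ∈-filter⁺ independent? (subsets-complete ⊥) ⊥-independent
                       , trans (∣⊥∣≡0 order) (sym α≡0)
    ... | inj₂ α∈  with ∈-map⁻ ∣_∣ α∈
    ...   | S , S∈ , α≡ = S , S∈ , sym α≡

    size≤α : ∀ {S} → S ∈ˡ independentSets → ∣ S ∣ ≤ α
    size≤α S∈ = All.lookup (xs≤max 0 (map ∣_∣ independentSets)) (∈-map⁺ ∣_∣ S∈)

    s-α≢0 : s α ≢ 0
    s-α≢0 = let S , S∈ , eq = α-attained in
      >⇒≢ (∈-length (∈-filter⁺ (λ S → ∣ S ∣ ≟ α) S∈ eq))

    s-bounded : ∀ k → α < k → s k ≡ 0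
    s-bounded k α<k = cong length (filter-none (λ S → ∣ S ∣ ≟ k)
      (All.tabulate λ S∈ eq → <⇒≱ α<k (subst (_≤ α) eq (size≤α S∈))))

  independencePolynomial : Polynomial
  independencePolynomial = record
    { degree    = α
    ; coeff     = s
    ; leading≢0 = s-α≢0
    ; bounded   = s-bounded
    }

-- ℤₙ is represented by the least residues Fin n; only its zero and its
-- multiplication are needed.
module ℤₙ (n : ℕ) .{{_ : NonZero n}} where

  infixl 7 _·_

  0# : Fin n
  0# = 0 mod n

  _·_ : Fin n → Fin n → Fin n
  a · b = (toℕ a * toℕ b) mod n

  ·-comm : ∀ a b → a · b ≡ b · a
  ·-comm a b = cong (_mod n) (*-comm (toℕ a) (toℕ b))

  NonZeroZeroDivisor : Pred (Fin n) 0ℓ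
  NonZeroZeroDivisor a = a ≢ 0# × ∃[ b ] (b ≢ 0# × a · b ≡ 0#)

  nonZeroZeroDivisor? : Decidable NonZeroZeroDivisor
  nonZeroZeroDivisor? a =
    ¬? (a ≟ᶠ 0#) ×-dec any? (λ b → ¬? (b ≟ᶠ 0#) ×-dec (a · b ≟ᶠ 0#))

zeroDivisorGraph : (n : ℕ) → .{{_ : NonZero n}} → FiniteGraph
zeroDivisorGraph n = record
  { order      = n
  ; Vertex     = NonZeroZeroDivisor
  ; Adj        = λ a b → (NonZeroZeroDivisor a × NonZeroZeroDivisor b) × a ≢ b × a · b ≡ 0#
  ; Vertex?    = nonZeroZeroDivisor?
  ; Adj?       = λ a b → (nonZeroZeroDivisor? a ×-dec nonZeroZeroDivisor? b)
                   ×-dec ¬? (a ≟ᶠ b) ×-dec (a · b ≟ᶠ 0#)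
  ; adj-vertex = proj₁
  ; adj-sym    = λ {a} {b} ((va , vb) , a≢b , ab≡0) →
                   (vb , va) , a≢b ∘ sym , trans (·-comm b a) ab≡0
  ; adj-irrefl = λ a≡b (_ , a≢b , _) → a≢b a≡b
  }
  where open ℤₙ n

{-# OPTIONS --safe #-}
-- Among the non-zero zero divisors of ℤ/p³, let W be those of p-adic valuation 1.  Two distinct
-- vertices are adjacent unless both lie in W, so the independent sets with at least two elements are
-- exactly the subsets of W with at least two elements.  With w = ∣W∣ = p² − p and v = p² − 1 vertices,
-- I(Γ, x) is therefore (1 + x)ʷ + (v − w) x.  Only the coefficient of x differs from a binomial
-- coefficient, and 2v ≤ 3w keeps it small enough for the inequalities in which it occurs.
module Submission where

open import Defs
open import Data.Bool.Base using (if_then_else_)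
open import Data.Fin.Base using (Fin; zero; suc; toℕ; fromℕ<)
open import Data.Fin.Properties using (toℕ<n; toℕ-fromℕ<; fromℕ<-cong; toℕ-injective)
  renaming (suc-injective to Fin-suc-injective)
open import Data.Fin.Subset using (Subset; inside; outside; ∣_∣; Lift; _∈_; _-_; Nonempty)
open import Data.Fin.Subset.Properties
  using (x∈p⇒∣p-x∣<∣p∣; x∈p∧x≢y⇒x∈p-y; nonempty?; Empty-unique; ∣⊥∣≡0)
open import Data.List.Base using ([]; _∷_; _++_; map; filter; length)
open import Data.List.Properties using (filter-++; filter-none; length-++)
open import Data.List.Relation.Unary.All using (universal)
open import Data.Nat.Base hiding (∣_-_∣)
open import Data.Nat.Combinatorics using (_C_; nC1≡n; nCk+nC[k+1]≡[n+1]C[k+1]; k>n⇒nCk≡0)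
open import Data.Nat.Divisibility
open import Data.Nat.DivMod using (_mod_; m%n<n)
open import Data.Nat.Primality using (Prime; prime⇒nonZero; prime⇒nonTrivial; euclidsLemma)
open import Data.Nat.Properties
open import Data.Nat.Tactic.RingSolver using (solve-∀)
open import Data.Product.Base using (_×_; _,_; proj₁; proj₂; ∃-syntax)
open import Data.Sum.Base using (inj₁; inj₂)
open import Data.Vec.Base using (here; there; []; _∷_)
open import Function.Base using (_∘_; case_of_)
open import Level using (Level; 0ℓ)
open import Relation.Binary.PropositionalEquality
  using (_≡_; _≢_; _≗_; refl; sym; trans; cong; cong₂; subst; subst₂; module ≡-Reasoning)
open import Relation.Nullary using (¬_; Dec; yes; no; does; contradiction)
open import Relation.Nullary.Decidable using (decidable-stable)
open import Relation.Unary using (Pred; Decidable; _≐_; _∩_)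
open import Relation.Unary.Properties using (_∩?_; ∁?)

-- Binomial coefficients: ratios, monotonicity, log-concavity.

-- This is `(k+1) C(n,k+1) = (n−k) C(n,k)` with the negative term moved to the left, which avoids
-- truncated subtraction and covers `k > n`. Induction on `n` by Pascal's rule.
C-absorption : ∀ n k → suc k * (n C suc k) + k * (n C k) ≡ n * (n C k)
C-absorption zero    zero    = refl
C-absorption zero    (suc k) = cong₂ _+_ (*-zeroʳ k) (*-zeroʳ k)
C-absorption (suc n) zero    = trans (cong (λ c → c + 0 + 0) (nC1≡n (suc n))) (lemma n)
  where
  lemma : ∀ n → suc n + 0 + 0 ≡ suc n * 1
  lemma = solve-∀
C-absorption (suc n) (suc k) = begin
  suc (suc k) * (suc n C suc (suc k)) + suc k * (suc n C suc k)
    ≡⟨ cong₂ (λ x y → suc (suc k) * x + suc k * y)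
         (nCk+nC[k+1]≡[n+1]C[k+1] n (suc k)) (nCk+nC[k+1]≡[n+1]C[k+1] n k) ⟨
  suc (suc k) * (b + c) + suc k * (a + b)
    ≡⟨ regroup k a b c ⟩
  (suc (suc k) * c + suc k * b) + (suc k * b + k * a) + (a + b)
    ≡⟨ cong₂ (λ x y → x + y + (a + b)) (C-absorption n (suc k)) (C-absorption n k) ⟩
  n * b + n * a + (a + b)
    ≡⟨ collect n a b ⟩
  suc n * (a + b)
    ≡⟨ cong (suc n *_) (nCk+nC[k+1]≡[n+1]C[k+1] n k) ⟩
  suc n * (suc n C suc k) ∎
  where
  open ≡-Reasoning
  a = n C k
  b = n C suc k
  c = n C suc (suc k)
  regroup : ∀ k a b c → suc (suc k) * (b + c) + suc k * (a + b)
          ≡ (suc (suc k) * c + suc k * b) + (suc k * b + k * a) + (a + b)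
  regroup = solve-∀
  collect : ∀ n a b → n * b + n * a + (a + b) ≡ suc n * (a + b)
  collect = solve-∀

C-ratio : ∀ k r → suc k * ((k + r) C suc k) ≡ r * ((k + r) C k)
C-ratio k r = +-cancelʳ-≡ (k * ((k + r) C k)) _ _ (begin
  suc k * ((k + r) C suc k) + k * ((k + r) C k) ≡⟨ C-absorption (k + r) k ⟩
  (k + r) * ((k + r) C k)                     ≡⟨ *-distribʳ-+ ((k + r) C k) k r ⟩
  k * ((k + r) C k) + r * ((k + r) C k)         ≡⟨ +-comm (k * ((k + r) C k)) _ ⟩
  r * ((k + r) C k) + k * ((k + r) C k)         ∎)
  where open ≡-Reasoning

C>0 : ∀ {n k} → k ≤ n → 0 < n C k
C>0 z≤n = z<s
C>0 (s≤s {k} {n} k≤n) = begin-strict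
  0                   <⟨ C>0 k≤n ⟩
  n C k               ≤⟨ m≤m+n (n C k) (n C suc k) ⟩
  n C k + n C suc k   ≡⟨ nCk+nC[k+1]≡[n+1]C[k+1] n k ⟩
  suc n C suc k       ∎
  where open ≤-Reasoning

-- By absorption, adding `k * (n C k)` to both sides of the claim multiplied by `k+1` leaves a
-- comparison of `2k+1` with `n`.
C-ascending : ∀ n k → suc (k + k) ≤ n → n C k ≤ n C suc k
C-ascending n k 2k<n = *-cancelˡ-≤ (suc k) (+-cancelʳ-≤ (k * (n C k)) _ _ (begin
  suc k * (n C k) + k * (n C k)     ≡⟨ *-distribʳ-+ (n C k) (suc k) k ⟨
  suc (k + k) * (n C k)             ≤⟨ *-monoˡ-≤ (n C k) 2k<n ⟩
  n * (n C k)                       ≡⟨ C-absorption n k ⟨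
  suc k * (n C suc k) + k * (n C k) ∎))
  where open ≤-Reasoning

C-descending : ∀ n k → n ≤ suc (k + k) → n C suc k ≤ n C k
C-descending n k n≤1+2k = *-cancelˡ-≤ (suc k) (+-cancelʳ-≤ (k * (n C k)) _ _ (begin
  suc k * (n C suc k) + k * (n C k) ≡⟨ C-absorption n k ⟩
  n * (n C k)                       ≤⟨ *-monoˡ-≤ (n C k) n≤1+2k ⟩
  suc (k + k) * (n C k)             ≡⟨ *-distribʳ-+ (n C k) (suc k) k ⟩
  suc k * (n C k) + k * (n C k)     ∎))
  where open ≤-Reasoning

C-logConcave : ∀ n k → (n C k) * (n C suc (suc k)) ≤ (n C suc k) * (n C suc k)
C-logConcave n k with suc k ≤? n
... | no k≮n = begin
  (n C k) * (n C suc (suc k)) ≡⟨ cong ((n C k) *_) (k>n⇒nCk≡0 (m<n⇒m<1+n (≰⇒> k≮n))) ⟩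
  (n C k) * 0                 ≡⟨ *-zeroʳ (n C k) ⟩
  0                           ≤⟨ z≤n ⟩
  (n C suc k) * (n C suc k)   ∎
  where open ≤-Reasoning
... | yes k<n with r , refl ← m≤n⇒∃[o]m+o≡n k<n =
  -- With `n = k+1+r`, this factor lets both ratio identities express `a` and `c` through `b`; what
  -- remains is `(k+1) r ≤ (k+2)(r+1)`.
  *-cancelˡ-≤ (suc r * suc (suc k)) (begin
  suc r * suc (suc k) * (a * c)     ≡⟨ interchange (suc r) (suc (suc k)) a c ⟩
  suc r * a * (suc (suc k) * c)     ≡⟨ cong₂ _*_ (sym ratio₁) (C-ratio (suc k) r) ⟩
  suc k * b * (r * b)               ≡⟨ interchange (suc k) r b b ⟨
  suc k * r * (b * b)               ≤⟨ *-monoˡ-≤ (b * b) (*-mono-≤ (n≤1+n (suc k)) (n≤1+n r)) ⟩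
  suc (suc k) * suc r * (b * b)     ≡⟨ cong (_* (b * b)) (*-comm (suc (suc k)) (suc r)) ⟩
  suc r * suc (suc k) * (b * b)     ∎)
  where
  open ≤-Reasoning
  a = (suc k + r) C k
  b = (suc k + r) C suc k
  c = (suc k + r) C suc (suc k)
  ratio₁ : suc k * b ≡ suc r * a
  ratio₁ = subst (λ n → suc k * (n C suc k) ≡ suc r * (n C k)) (+-suc k r) (C-ratio k (suc r))
  interchange : ∀ x y z w → x * y * (z * w) ≡ x * z * (y * w)
  interchange = solve-∀

C₂ : ∀ r → 2 * ((2 + r) C 2) ≡ suc r * (2 + r)
C₂ r = trans (C-ratio 1 (suc r)) (cong (suc r *_) (nC1≡n (2 + r)))

-- The binomial sequence with a modified linear coefficient.

-- The coefficients of (1 + x)ⁿ + (v − n) x.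
bumped : ℕ → ℕ → ℕ → ℕ
bumped n v 0             = 1
bumped n v 1             = v
bumped n v (suc (suc k)) = n C suc (suc k)

bumped>0 : ∀ {n v} → 0 < v → ∀ k → k ≤ n → 0 < bumped n v k
bumped>0 0<v 0             _   = z<s
bumped>0 0<v 1             _   = 0<v
bumped>0 0<v (suc (suc k)) k≤n = C>0 k≤n

module _ {r v : ℕ} (n≤v : 2 + r ≤ v) (2v≤3n : 2 * v ≤ 3 * (2 + r)) where

  private
    n : ℕ
    n = 2 + r

  -- Only two inequalities involve `v`: at `k = 0` it is the middle term, so `n ≤ v` helps; at
  -- `k = 1` it is an outer term, and `2v ≤ 3n` bounds it.
  bumped-logConcave : ∀ k →
    bumped n v k * bumped n v (suc (suc k)) ≤ bumped n v (suc k) * bumped n v (suc k)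
  bumped-logConcave 0 = begin
    1 * (n C 2)       ≤⟨ C-logConcave n 0 ⟩
    (n C 1) * (n C 1) ≡⟨ cong₂ _*_ (nC1≡n n) (nC1≡n n) ⟩
    n * n             ≤⟨ *-mono-≤ n≤v n≤v ⟩
    v * v             ∎
    where open ≤-Reasoning
  -- The factor 6 is 2 for `2v ≤ 3n` times 3 for `3 C(n,3) = r C(n,2)`; the slack comes from
  -- `r ≤ r+1`.
  bumped-logConcave 1 = *-cancelˡ-≤ 6 (begin
    6 * (v * (n C 3))               ≡⟨ lemma₁ v (n C 3) ⟩
    2 * v * (3 * (n C 3))           ≡⟨ cong (2 * v *_) (C-ratio 2 r) ⟩
    2 * v * (r * (n C 2))           ≤⟨ *-mono-≤ 2v≤3n (*-monoˡ-≤ (n C 2) (n≤1+n r)) ⟩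
    3 * n * (suc r * (n C 2))       ≡⟨ lemma₂ r (n C 2) ⟩
    3 * (suc r * n) * (n C 2)       ≡⟨ cong (λ x → 3 * x * (n C 2)) (C₂ r) ⟨
    3 * (2 * (n C 2)) * (n C 2)     ≡⟨ lemma₃ (n C 2) ⟩
    6 * ((n C 2) * (n C 2))         ∎)
    where
    open ≤-Reasoning
    lemma₁ : ∀ v c → 6 * (v * c) ≡ 2 * v * (3 * c)
    lemma₁ = solve-∀
    lemma₂ : ∀ r c → 3 * (2 + r) * (suc r * c) ≡ 3 * (suc r * (2 + r)) * c
    lemma₂ = solve-∀
    lemma₃ : ∀ c → 3 * (2 * c) * c ≡ 6 * (c * c)
    lemma₃ = solve-∀
  bumped-logConcave (suc (suc k)) = C-logConcave n (suc (suc k))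

  -- The range is `2k+2 ≤ n`, not the `2k+1 ≤ n` of pure binomials: at `k = 1` the enlarged `v`
  -- calls for `n ≥ 4`, whereas `n = 3`, `v = 4` would fail.
  bumped-ascending : ∀ k → suc k + suc k ≤ n → bumped n v k ≤ bumped n v (suc k)
  bumped-ascending 0 _ = ≤-trans (s≤s z≤n) n≤v
  bumped-ascending 1 (s≤s (s≤s 2≤r)) = *-cancelˡ-≤ 2 (begin
    2 * v       ≤⟨ 2v≤3n ⟩
    3 * n       ≤⟨ *-monoˡ-≤ n (s≤s 2≤r) ⟩
    suc r * n   ≡⟨ C₂ r ⟨
    2 * (n C 2) ∎)
    where open ≤-Reasoning
  bumped-ascending k@(suc (suc _)) 2k+2≤n =
    C-ascending n k (≤-trans (+-monoˡ-≤ k (n≤1+n (suc k))) (subst (_≤ n) (cong suc (+-suc k k)) 2k+2≤n))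

  bumped-descending : ∀ k → n ≤ suc (k + k) → bumped n v (suc k) ≤ bumped n v k
  bumped-descending 0 (s≤s ())
  bumped-descending 1 n≤3 = begin
    n C 2 ≤⟨ C-descending n 1 n≤3 ⟩
    n C 1 ≡⟨ nC1≡n n ⟩
    n     ≤⟨ n≤v ⟩
    v     ∎
    where open ≤-Reasoning
  bumped-descending k@(suc (suc _)) n≤1+2k = C-descending n k n≤1+2k

-- Transfer to polynomials.

module _ (f : Polynomial) where
  open Polynomial f

  logConcave⁺ : (∀ k → coeff k * coeff (suc (suc k)) ≤ coeff (suc k) * coeff (suc k)) → LogConcave f
  logConcave⁺ h (suc k) _ _ = begin
    coeff k * coeff (suc k + 1)     ≡⟨ cong (λ i → coeff k * coeff i) (+-comm (suc k) 1) ⟩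
    coeff k * coeff (suc (suc k))   ≤⟨ h k ⟩
    coeff (suc k) * coeff (suc k)   ≡⟨ cong (coeff (suc k) *_) (*-identityʳ (coeff (suc k))) ⟨
    coeff (suc k) ^ 2               ∎
    where open ≤-Reasoning

  -- Coefficients beyond the degree vanish, so a positive one at `m` forces `m ≤ degree`; the degree
  -- itself is never computed.
  unimodal⁺ : ∀ m → 0 < coeff m → (∀ i → i < m → coeff i ≤ coeff (suc i)) →
              (∀ i → m ≤ i → coeff (suc i) ≤ coeff i) → Unimodal f
  unimodal⁺ m 0<cₘ ascending descending =
    m , ≮⇒≥ (λ deg<m → >⇒≢ 0<cₘ (bounded m deg<m))
      , (λ i i<m → subst (λ j → coeff i ≤ coeff j) (+-comm 1 i) (ascending i i<m))
      , (λ i m≤i _ → subst (λ j → coeff j ≤ coeff i) (+-comm 1 i) (descending i m≤i))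

  bumped⇒logConcave×unimodal : ∀ {n v} → 2 ≤ n → n ≤ v → 2 * v ≤ 3 * n →
                               coeff ≗ bumped n v → LogConcave f × Unimodal f
  bumped⇒logConcave×unimodal {n@(suc (suc _))} {v} (s≤s (s≤s _)) n≤v 2v≤3n coeff≗ =
      logConcave⁺ (λ k → subst₂ _≤_ (sym (cong₂ _*_ (coeff≗ k) (coeff≗ (suc (suc k)))))
                                    (sym (cong₂ _*_ (coeff≗ (suc k)) (coeff≗ (suc k))))
                                    (bumped-logConcave n≤v 2v≤3n k))
    -- The mode is `⌊ n /2⌋`: below it `2i+2 ≤ n`, and from it on `n ≤ 2i+1`, the two ranges
    -- required above.
    , unimodal⁺ ⌊ n /2⌋ (subst (0 <_) (sym (coeff≗ _)) (bumped>0 (≤-trans z<s n≤v) ⌊ n /2⌋ (⌊n/2⌋≤n n)))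
        (λ i i<m → subst₂ _≤_ (sym (coeff≗ i)) (sym (coeff≗ (suc i)))
          (bumped-ascending n≤v 2v≤3n i (ascending-range i<m)))
        (λ i m≤i → subst₂ _≤_ (sym (coeff≗ (suc i))) (sym (coeff≗ i))
          (bumped-descending n≤v 2v≤3n i (descending-range m≤i)))
    where
    open ≤-Reasoning
    ascending-range : ∀ {i} → i < ⌊ n /2⌋ → suc i + suc i ≤ n
    ascending-range {i} i<m = begin
      suc i + suc i         ≤⟨ +-mono-≤ i<m (≤-trans i<m (⌊n/2⌋≤⌈n/2⌉ n)) ⟩
      ⌊ n /2⌋ + ⌈ n /2⌉     ≡⟨ ⌊n/2⌋+⌈n/2⌉≡n n ⟩
      n                     ∎
    descending-range : ∀ {i} → ⌊ n /2⌋ ≤ i → n ≤ suc (i + i)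
    descending-range {i} m≤i = begin
      n                     ≡⟨ ⌊n/2⌋+⌈n/2⌉≡n n ⟨
      -- `⌈ n /2⌉` is `⌊ n+1 /2⌋`, at most `⌊ n+2 /2⌋ = ⌊ n /2⌋ + 1`.
      ⌊ n /2⌋ + ⌈ n /2⌉     ≤⟨ +-mono-≤ m≤i (≤-trans (⌊n/2⌋-mono (n≤1+n (suc n))) (s≤s m≤i)) ⟩
      i + suc i             ≡⟨ +-suc i i ⟩
      suc (i + i)           ∎

-- Counting elements and subsets.

private variable
  ℓ ℓ′ : Level
  A B : Set ℓ
  n : ℕ

module _ {P : Pred A ℓ} {Q : Pred A ℓ′} (P? : Decidable P) (Q? : Decidable Q) where

  filter-filter : ∀ xs → filter P? (filter Q? xs) ≡ filter (P? ∩? Q?) xs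
  filter-filter []       = refl
  filter-filter (x ∷ xs) with Q? x | P? x in eq
  ... | no  _ | no  _ = filter-filter xs
  ... | no  _ | yes _ = filter-filter xs
  ... | yes _ | no  _ rewrite eq = filter-filter xs
  ... | yes _ | yes _ rewrite eq = cong (x ∷_) (filter-filter xs)

length-filter-map : {P : Pred B ℓ} (P? : Decidable P) (f : A → B) → ∀ xs →
                    length (filter P? (map f xs)) ≡ length (filter (P? ∘ f) xs)
length-filter-map P? f []       = refl
length-filter-map P? f (x ∷ xs) with P? (f x)
... | no  _ = length-filter-map P? f xs
... | yes _ = cong suc (length-filter-map P? f xs)

-- The number of elements satisfying `P`, by the same recursion on `n` as `subsets`, so that the two
-- can be compared by induction.
# : {P : Pred (Fin n) ℓ} → Decidable P → ℕ
# {n = zero}  P? = 0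
# {n = suc n} P? = (if does (P? zero) then 1 else 0) + # (P? ∘ suc)

#-none : {P : Pred (Fin n) ℓ} (P? : Decidable P) → (∀ i → ¬ P i) → # P? ≡ 0
#-none {n = zero}  P? ¬P = refl
#-none {n = suc n} P? ¬P with P? zero
... | yes p = contradiction p (¬P zero)
... | no  _ = #-none (P? ∘ suc) (¬P ∘ suc)

#-cong : {P : Pred (Fin n) ℓ} {Q : Pred (Fin n) ℓ′} (P? : Decidable P) (Q? : Decidable Q) →
         P ≐ Q → # P? ≡ # Q?
#-cong {n = zero}  P? Q? P≐Q = refl
#-cong {n = suc n} P? Q? P≐Q@(P⊆Q , Q⊆P) with P? zero | Q? zero
... | yes _ | yes _ = cong suc (#-cong (P? ∘ suc) (Q? ∘ suc) (P⊆Q , Q⊆P))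
... | no  _ | no  _ = #-cong (P? ∘ suc) (Q? ∘ suc) (P⊆Q , Q⊆P)
... | yes p | no ¬q = contradiction (P⊆Q p) ¬q
... | no ¬p | yes q = contradiction (Q⊆P q) ¬p

#-difference : {P : Pred (Fin n) ℓ} {Q : Pred (Fin n) ℓ′} (P? : Decidable P) (Q? : Decidable Q) →
               (∀ {i} → Q i → P i) → # (P? ∩? ∁? Q?) + # Q? ≡ # P?
#-difference {n = zero}  P? Q? Q⊆P = refl
#-difference {n = suc n} P? Q? Q⊆P with P? zero | Q? zero | #-difference (P? ∘ suc) (Q? ∘ suc) Q⊆P
... | yes _ | yes _ | ih = trans (+-suc _ _) (cong suc ih)
... | yes _ | no  _ | ih = cong suc ih
... | no ¬p | yes q | ih = contradiction (Q⊆P q) ¬p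
... | no  _ | no  _ | ih = ih

#-+ : ∀ m {P : Pred ℕ ℓ} (P? : Decidable P) →
      # {n = m + n} (P? ∘ toℕ) ≡ # {n = m} (P? ∘ toℕ) + # {n = n} (P? ∘ (m +_) ∘ toℕ)
#-+ zero    P? = refl
#-+ (suc m) P? = trans (cong (c₀ +_) (#-+ m (P? ∘ suc))) (sym (+-assoc c₀ _ _))
  where c₀ = if does (P? 0) then 1 else 0

-- The interval from 0 to `m * d − 1` splits into `m` blocks of length `d`, and only the first
-- element of each block is a multiple of `d`.
#-multiples : ∀ d .{{_ : NonZero d}} m → # {n = m * d} (λ i → d ∣? toℕ i) ≡ m
#-multiples d         zero    = refl
#-multiples d@(suc d′) (suc m) = begin
  # {n = d + m * d} (λ i → d ∣? toℕ i)
    ≡⟨ #-+ d (d ∣?_) ⟩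
  # {n = d} (λ i → d ∣? toℕ i) + # {n = m * d} (λ i → d ∣? (d + toℕ i))
    ≡⟨ cong₂ _+_ first (#-cong {n = m * d} (λ i → d ∣? (d + toℕ i)) (λ i → d ∣? toℕ i)
         ((λ h → ∣m+n∣m⇒∣n h ∣-refl) , ∣m∣n⇒∣m+n ∣-refl)) ⟩
  1 + # {n = m * d} (λ i → d ∣? toℕ i)
    ≡⟨ cong suc (#-multiples d m) ⟩
  suc m ∎
  where
  open ≡-Reasoning
  first : # {n = d} (λ i → d ∣? toℕ i) ≡ 1
  first with d ∣? 0
  ... | yes _  = cong suc (#-none {n = d′} (λ i → d ∣? suc (toℕ i)) (λ i → >⇒∤ (s<s (toℕ<n i))))
  ... | no d∤0 = contradiction (d ∣0) d∤0

-- Pascal's rule, splitting the subsets by whether they contain `zero`. Allowing any `P` equivalent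
-- to "inside `Q`, of size `k`" lets the recursion go through and lets independence be plugged in
-- later.
count-subsets : {Q : Pred (Fin n) ℓ} (Q? : Decidable Q) → ∀ k →
                {P : Pred (Subset n) ℓ′} (P? : Decidable P) → P ≐ Lift Q ∩ (λ S → ∣ S ∣ ≡ k) →
                length (filter P? (subsets n)) ≡ # Q? C k
count-subsets {n = zero} Q? k P? (P⇒ , ⇒P) with P? [] | k
... | yes p | zero  = refl
... | yes p | suc k with () ← proj₂ (P⇒ p)
... | no ¬p | zero  = contradiction (⇒P ((λ ()) , refl)) ¬p
... | no ¬p | suc k = refl
count-subsets {n = suc n} {Q = Q} Q? k {P = P} P? (P⇒ , ⇒P) = begin
  length (filter P? (map (outside ∷_) (subsets n) ++ map (inside ∷_) (subsets n)))
    ≡⟨ cong length (filter-++ P? (map (outside ∷_) (subsets n)) _) ⟩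
  length (filter P? (map (outside ∷_) (subsets n)) ++ filter P? (map (inside ∷_) (subsets n)))
    ≡⟨ length-++ (filter P? (map (outside ∷_) (subsets n))) ⟩
  length (filter P? (map (outside ∷_) (subsets n))) + length (filter P? (map (inside ∷_) (subsets n)))
    ≡⟨ cong₂ _+_ (length-filter-map P? (outside ∷_) (subsets n))
                  (length-filter-map P? (inside ∷_) (subsets n)) ⟩
  length (filter (P? ∘ (outside ∷_)) (subsets n)) + length (filter (P? ∘ (inside ∷_)) (subsets n))
    ≡⟨ cong (_+ length (filter (P? ∘ (inside ∷_)) (subsets n)))
         (count-subsets (Q? ∘ suc) k (P? ∘ (outside ∷_))
           ( (λ p → (λ x∈S → proj₁ (P⇒ p) (there x∈S)) , proj₂ (P⇒ p))
           , (λ (S⊆Q , eq) → ⇒P ((λ { (there x∈S) → S⊆Q x∈S }) , eq)))) ⟩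
  # (Q? ∘ suc) C k + length (filter (P? ∘ (inside ∷_)) (subsets n))
    ≡⟨ with-zero (Q? zero) k P⇒ ⇒P ⟩
  ((if does (Q? zero) then 1 else 0) + # (Q? ∘ suc)) C k ∎
  where
  open ≡-Reasoning
  c = # (Q? ∘ suc)
  -- Sets containing `zero` contribute nothing if `zero` is not in `Q` or if `k` is 0; otherwise
  -- they contribute `c C (k−1)`.
  with-zero : (q? : Dec (Q zero)) → ∀ k →
    (∀ {S} → P S → (Lift Q ∩ (λ S → ∣ S ∣ ≡ k)) S) →
    (∀ {S} → (Lift Q ∩ (λ S → ∣ S ∣ ≡ k)) S → P S) →
    c C k + length (filter (P? ∘ (inside ∷_)) (subsets n)) ≡ ((if does q? then 1 else 0) + c) C k
  with-zero (no ¬q) k P⇒ _ = trans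
    (cong (λ l → c C k + length l)
      (filter-none (P? ∘ (inside ∷_)) (universal (λ S p → ¬q (proj₁ (P⇒ p) here)) (subsets n))))
    (+-identityʳ (c C k))
  with-zero (yes q) zero P⇒ _ =
    cong (λ l → 1 + length l)
      (filter-none (P? ∘ (inside ∷_)) (universal (λ S p → case proj₂ (P⇒ p) of λ ()) (subsets n)))
  with-zero (yes q) (suc k) P⇒ ⇒P = begin
    c C suc k + length (filter (P? ∘ (inside ∷_)) (subsets n))
      ≡⟨ cong (c C suc k +_) (count-subsets (Q? ∘ suc) k (P? ∘ (inside ∷_))
           ( (λ p → (λ x∈S → proj₁ (P⇒ p) (there x∈S)) , suc-injective (proj₂ (P⇒ p)))
           , (λ (S⊆Q , eq) → ⇒P ((λ { here → q ; (there x∈S) → S⊆Q x∈S }) , cong suc eq)))) ⟩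
    c C suc k + c C k ≡⟨ +-comm (c C suc k) (c C k) ⟩
    c C k + c C suc k ≡⟨ nCk+nC[k+1]≡[n+1]C[k+1] c k ⟩
    suc c C suc k ∎

-- Subsets with at least two elements.

-- Removing `y` and then `x` lowers the size each time.
two-elements⇒2≤∣p∣ : {p : Subset n} {x y : Fin n} → x ∈ p → y ∈ p → x ≢ y → 2 ≤ ∣ p ∣
two-elements⇒2≤∣p∣ {p = p} {x} {y} x∈p y∈p x≢y = begin
  2               ≤⟨ s≤s (≤-trans z<s (x∈p⇒∣p-x∣<∣p∣ (x∈p∧x≢y⇒x∈p-y x∈p x≢y))) ⟩
  suc ∣ p - y ∣   ≤⟨ x∈p⇒∣p-x∣<∣p∣ y∈p ⟩
  ∣ p ∣           ∎
  where open ≤-Reasoning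

∣p∣>0⇒nonempty : (p : Subset n) → 0 < ∣ p ∣ → Nonempty p
∣p∣>0⇒nonempty {n} p 0<∣p∣ with nonempty? p
... | yes ne = ne
... | no ¬ne = contradiction (trans (cong ∣_∣ (Empty-unique ¬ne)) (∣⊥∣≡0 n)) (>⇒≢ 0<∣p∣)

2≤∣p∣⇒another-element : (p : Subset n) (x : Fin n) → 2 ≤ ∣ p ∣ → ∃[ y ] y ∈ p × y ≢ x
2≤∣p∣⇒another-element (inside ∷ p)  zero    (s≤s 1≤∣p∣)
  with y , y∈p ← ∣p∣>0⇒nonempty p 1≤∣p∣ =
  suc y , there y∈p , λ ()
2≤∣p∣⇒another-element (inside ∷ p)  (suc x) _ =
  zero , here , λ ()
2≤∣p∣⇒another-element (outside ∷ p) zero    2≤∣p∣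
  with y , y∈p ← ∣p∣>0⇒nonempty p (<⇒≤ 2≤∣p∣) =
  suc y , there y∈p , λ ()
2≤∣p∣⇒another-element (outside ∷ p) (suc x) 2≤∣p∣
  with y , y∈p , y≢x ← 2≤∣p∣⇒another-element p x 2≤∣p∣ =
  suc y , there y∈p , y≢x ∘ Fin-suc-injective

-- Divisibility and residues.

-- Euclid's lemma moves one factor `p` at a time into `b`; cancelling it lowers the exponent.
prime-power-cancel : ∀ {p} → Prime p → ∀ k {a b} → p ∤ a → p ^ k ∣ a * b → p ^ k ∣ b
prime-power-cancel pr zero    p∤a _ = 1∣ _
prime-power-cancel {p} pr (suc k) {a} {b} p∤a pᵏ⁺¹∣ab
  with euclidsLemma a b pr (∣-trans (m∣m*n (p ^ k)) pᵏ⁺¹∣ab)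
... | inj₁ p∣a = contradiction p∣a p∤a
... | inj₂ (divides-refl c) = subst (p ^ suc k ∣_) (*-comm p c)
  (*-monoʳ-∣ p (prime-power-cancel pr k p∤a (*-cancelˡ-∣ p {{prime⇒nonZero pr}}
    (subst (p ^ suc k ∣_) (lemma a c p) pᵏ⁺¹∣ab))))
  where
  lemma : ∀ a c p → a * (c * p) ≡ p * (a * c)
  lemma = solve-∀

module _ (n : ℕ) .{{_ : NonZero n}} where
  open ℤₙ n

  mod≡0⇒∣ : ∀ m → m mod n ≡ 0# → n ∣ m
  mod≡0⇒∣ m eq = m%n≡0⇒n∣m m n (begin
    m % n          ≡⟨ toℕ-fromℕ< (m%n<n m n) ⟨
    toℕ (m mod n)  ≡⟨ cong toℕ eq ⟩
    toℕ (0 mod n)  ≡⟨ toℕ-fromℕ< (m%n<n 0 n) ⟩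
    0 % n          ≡⟨ n∣m⇒m%n≡0 0 n (n ∣0) ⟩
    0              ∎)
    where open ≡-Reasoning

  ∣⇒mod≡0 : ∀ m → n ∣ m → m mod n ≡ 0#
  ∣⇒mod≡0 m n∣m = fromℕ<-cong _ _ (trans (n∣m⇒m%n≡0 m n n∣m) (sym (n∣m⇒m%n≡0 0 n (n ∣0)))) _ _

  ∣⇒≡0# : ∀ {a} → n ∣ toℕ a → a ≡ 0#
  ∣⇒≡0# {a} n∣a = toℕ-injective (begin
    toℕ a          ≡⟨ lemma (toℕ a) (toℕ<n a) n∣a ⟩
    0              ≡⟨ n∣m⇒m%n≡0 0 n (n ∣0) ⟨
    0 % n          ≡⟨ toℕ-fromℕ< (m%n<n 0 n) ⟨
    toℕ (0 mod n)  ∎)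
    where
    open ≡-Reasoning
    lemma : ∀ m → m < n → n ∣ m → m ≡ 0
    lemma zero    _   _   = refl
    lemma (suc m) m<n n∣m = contradiction n∣m (>⇒∤ m<n)

  ≡0#⇒∣ : ∀ {a} → a ≡ 0# → n ∣ toℕ a
  ≡0#⇒∣ refl = subst (n ∣_) (sym (trans (toℕ-fromℕ< (m%n<n 0 n)) (n∣m⇒m%n≡0 0 n (n ∣0)))) (n ∣0)

-- Independent sets of the zero divisor graph modulo `p ^ 3`.

module PrimeCube (p : ℕ) (pr : Prime p) where

  instance
    p≢0 : NonZero p
    p≢0 = prime⇒nonZero pr

    p³≢0 : NonZero (p ^ 3)
    p³≢0 = m^n≢0 p 3 {{prime⇒nonZero pr}}

  p³ = p ^ 3
  Γ = zeroDivisorGraph p³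
  open FiniteGraph Γ using (Vertex; Adj)
  open ℤₙ p³

  -- In terms of the p-adic valuation of the representative, `V` means 1 or 2, and `W` means exactly
  -- 1.
  V W : Pred (Fin p³) 0ℓ
  V a = p ∣ toℕ a × p ^ 3 ∤ toℕ a
  W a = p ∣ toℕ a × p ^ 2 ∤ toℕ a

  multiple? : ∀ k → Decidable (λ (a : Fin p³) → k ∣ toℕ a)
  multiple? k a = k ∣? toℕ a

  V? : Decidable V
  V? = (multiple? p) ∩? ∁? (multiple? (p ^ 3))

  W? : Decidable W
  W? = (multiple? p) ∩? ∁? (multiple? (p ^ 2))

  p²<p³ : p ^ 2 < p ^ 3
  p²<p³ = ^-monoʳ-< p (nonTrivial⇒n>1 p {{prime⇒nonTrivial pr}}) (n<1+n 2)

  vertex⇒V : ∀ {a} → Vertex a → V a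
  vertex⇒V {a} (a≢0 , b , b≢0 , ab≡0) =
    -- If `p` did not divide `a`, cancelling `a` from `p ^ 3 ∣ a * b` would make `b` zero.
    decidable-stable (p ∣? toℕ a) (λ p∤a →
      b≢0 (∣⇒≡0# p³ (prime-power-cancel pr 3 p∤a (mod≡0⇒∣ p³ (toℕ a * toℕ b) ab≡0))))
    , a≢0 ∘ ∣⇒≡0# p³

  V⇒vertex : ∀ {a} → V a → Vertex a
  V⇒vertex {a} (p∣a , p³∤a) =
    p³∤a ∘ ≡0#⇒∣ p³ , b , (λ b≡0 → >⇒∤ {{m^n≢0 p 2}} p²<p³ (subst (p³ ∣_) toℕ-b (≡0#⇒∣ p³ b≡0)))
    , ∣⇒mod≡0 p³ (toℕ a * toℕ b) (*-pres-∣ p∣a (∣-reflexive (sym toℕ-b)))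
    -- The residue `p ^ 2` annihilates every multiple of `p`, and it is non-zero because
    -- `p ^ 2 < p ^ 3`.
    where
    b : Fin p³
    b = fromℕ< p²<p³
    toℕ-b : toℕ b ≡ p ^ 2
    toℕ-b = toℕ-fromℕ< p²<p³

  W⇒V : ∀ {a} → W a → V a
  W⇒V (p∣a , p²∤a) = p∣a , p²∤a ∘ ∣-trans (n∣m*n p)

  -- With `a = c p` and `b = d p`, divisibility of `a b` by `p ^ 3` gives `p ∣ c * d`, so `p ^ 2`
  -- divides `a` or `b`.
  W-nonadjacent : ∀ {a b} → W a → W b → ¬ Adj a b
  W-nonadjacent {a} {b} (p∣a , p²∤a) (p∣b , p²∤b) (_ , _ , ab≡0) =
    valuations p∣a p∣b p²∤a p²∤b (mod≡0⇒∣ p³ (toℕ a * toℕ b) ab≡0)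
    where
    lift : ∀ {c} → p ∣ c → p ^ 2 ∣ c * p
    lift {c} p∣c = subst (p ^ 2 ∣_) (*-comm p c) (*-monoʳ-∣ p (subst (_∣ c) (sym (*-identityʳ p)) p∣c))
    lemma : ∀ c d p → c * p * (d * p) ≡ p * (p * (c * d))
    lemma = solve-∀
    valuations : ∀ {x y} → p ∣ x → p ∣ y → p ^ 2 ∤ x → p ^ 2 ∤ y → p ^ 3 ∤ x * y
    valuations (divides-refl c) (divides-refl d) p²∤x p²∤y p³∣xy
      with euclidsLemma c d pr (subst (_∣ c * d) (*-identityʳ p)
        (*-cancelˡ-∣ p (*-cancelˡ-∣ p (subst (p ^ 3 ∣_) (lemma c d p) p³∣xy))))
    ... | inj₁ p∣c = p²∤x (lift p∣c)
    ... | inj₂ p∣d = p²∤y (lift p∣d)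

  independent⇒V : ∀ {S} → Independent Γ S → Lift V S
  independent⇒V (vertices , _) = vertex⇒V ∘ vertices

  V⇒independent : ∀ {S} → ∣ S ∣ < 2 → Lift V S → Independent Γ S
  V⇒independent ∣S∣<2 S⊆V = V⇒vertex ∘ S⊆V , λ a∈S b∈S (_ , a≢b , _) →
    <⇒≱ ∣S∣<2 (two-elements⇒2≤∣p∣ a∈S b∈S a≢b)

  -- If `p ^ 2` divided some `a` in `S`, any other element of `S`, being a multiple of `p`, would be
  -- adjacent to `a`.
  independent⇒W : ∀ {S} → 2 ≤ ∣ S ∣ → Independent Γ S → Lift W S
  independent⇒W {S} 2≤∣S∣ ind@(vertices , nonadjacent) {a} a∈S = proj₁ (independent⇒V ind a∈S) , λ p²∣a →
    let b , b∈S , b≢a = 2≤∣p∣⇒another-element S a 2≤∣S∣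
    in nonadjacent b∈S a∈S ((vertices b∈S , vertices a∈S) , b≢a
         , ∣⇒mod≡0 p³ (toℕ b * toℕ a) (*-pres-∣ (proj₁ (independent⇒V ind b∈S)) p²∣a))

  W⇒independent : ∀ {S} → Lift W S → Independent Γ S
  W⇒independent S⊆W = V⇒vertex ∘ W⇒V ∘ S⊆W , λ a∈S b∈S → W-nonadjacent (S⊆W a∈S) (S⊆W b∈S)

  module _ {Q : Pred (Fin p³) 0ℓ} (Q? : Decidable Q) where

    -- The equivalence is asked only for sets of size `k`, since the right `Q` depends on the size:
    -- `V` for sizes 0 and 1, where no distinct pair exists, and `W` from 2 on.
    s≡C : ∀ k → (∀ {S} → ∣ S ∣ ≡ k → Independent Γ S → Lift Q S) →
                (∀ {S} → ∣ S ∣ ≡ k → Lift Q S → Independent Γ S) → s Γ k ≡ # Q? C k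
    s≡C k to from = trans
      (cong length (filter-filter (λ S → ∣ S ∣ ≟ k) (independent? Γ) (subsets p³)))
      (count-subsets Q? k _ ((λ (eq , ind) → to eq ind , eq) , (λ (S⊆Q , eq) → eq , from eq S⊆Q)))

  s≗bumped : s Γ ≗ bumped (# W?) (# V?)
  s≗bumped 0 = s≡C V? 0 (λ _ → independent⇒V) (λ eq → V⇒independent (subst (_< 2) (sym eq) z<s))
  s≗bumped 1 = trans
    (s≡C V? 1 (λ _ → independent⇒V) (λ eq → V⇒independent (subst (_< 2) (sym eq) (s≤s z<s))))
    (nC1≡n (# V?))
  s≗bumped k@(suc (suc _)) =
    s≡C W? k (λ eq → independent⇒W (subst (2 ≤_) (sym eq) (s≤s (s≤s z≤n)))) (λ _ → W⇒independent)

  #-multiples-of : ∀ d .{{_ : NonZero d}} m → p³ ≡ m * d → # (multiple? d) ≡ m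
  #-multiples-of d m eq = trans (cong (λ N → # {n = N} (λ i → d ∣? toℕ i)) eq) (#-multiples d m)

  -- Below `p ^ 3` there are `p ^ 2` multiples of `p`; only 0 is a multiple of `p ^ 3`.
  #V : # V? + 1 ≡ p ^ 2
  #V = begin
    # V? + 1                       ≡⟨ cong (# V? +_) (#-multiples-of p³ 1 (sym (+-identityʳ p³))) ⟨
    # V? + # (multiple? (p ^ 3))   ≡⟨ #-difference (multiple? p) (multiple? (p ^ 3))
                                          (∣-trans (m∣m*n (p ^ 2))) ⟩
    # (multiple? p)                ≡⟨ #-multiples-of p (p ^ 2) (*-comm p (p ^ 2)) ⟩
    p ^ 2                          ∎
    where open ≡-Reasoning

  -- Of the `p ^ 2` multiples of `p`, exactly `p` are multiples of `p ^ 2`.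
  #W : # W? + p ≡ p ^ 2
  #W = begin
    # W? + p                       ≡⟨ cong (# W? +_) (#-multiples-of (p ^ 2) {{m^n≢0 p 2}} p refl) ⟨
    # W? + # (multiple? (p ^ 2))   ≡⟨ #-difference (multiple? p) (multiple? (p ^ 2))
                                          (∣-trans (m∣m*n (p ^ 1))) ⟩
    # (multiple? p)                ≡⟨ #-multiples-of p (p ^ 2) (*-comm p (p ^ 2)) ⟩
    p ^ 2                          ∎
    where open ≡-Reasoning

-- Numerical bounds and conclusion.

-- With `p = q+2`, `w = (q+1)(q+2)` and `v = w + (q+1)`, so `2v ≤ 3w` amounts to `2 ≤ q+2`, with
-- equality at `p = 2`.
cardinality-bounds : ∀ {p v w} → 2 ≤ p → v + 1 ≡ p ^ 2 → w + p ≡ p ^ 2 →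
                     2 ≤ w × w ≤ v × 2 * v ≤ 3 * w
cardinality-bounds {suc (suc q)} {v} {w} (s≤s (s≤s _)) v+1≡p² w+p≡p² =
    subst (2 ≤_) (sym w≡) (*-mono-≤ {1} {suc q} (s≤s z≤n) (s≤s (s≤s z≤n)))
  , subst (w ≤_) (sym v≡) (m≤m+n w (suc q))
  , (begin
    2 * v                       ≡⟨ cong (2 *_) v≡ ⟩
    2 * (w + suc q)             ≡⟨ lemma w q ⟩
    2 * w + suc q * 2           ≤⟨ +-monoʳ-≤ (2 * w) (*-monoʳ-≤ (suc q) (s≤s (s≤s z≤n))) ⟩
    2 * w + suc q * suc (suc q) ≡⟨ cong (2 * w +_) w≡ ⟨
    2 * w + w                   ≡⟨ +-comm (2 * w) w ⟩
    3 * w                       ∎)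
  where
  open ≤-Reasoning
  square : ∀ q → (2 + q) * ((2 + q) * 1) ≡ (1 + q) * (2 + q) + (2 + q)
  square = solve-∀
  w≡ : w ≡ suc q * suc (suc q)
  w≡ = +-cancelʳ-≡ (2 + q) w _ (trans w+p≡p² (square q))
  shift : ∀ w q → w + (2 + q) ≡ w + (1 + q) + 1
  shift = solve-∀
  v≡ : v ≡ w + suc q
  v≡ = +-cancelʳ-≡ 1 v _ (trans v+1≡p² (trans (sym w+p≡p²) (shift w q)))
  lemma : ∀ w q → 2 * (w + (1 + q)) ≡ 2 * w + (1 + q) * 2
  lemma = solve-∀

theorem2p2 : (p : ℕ) (pr : Prime p) →
    let I = independencePolynomial
              (zeroDivisorGraph (p ^ 3) {{m^n≢0 p 3 {{prime⇒nonZero pr}}}})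
    in LogConcave I × Unimodal I
theorem2p2 p pr =
  let 2≤w , w≤v , 2v≤3w = cardinality-bounds (nonTrivial⇒n>1 p {{prime⇒nonTrivial pr}}) #V #W
  in bumped⇒logConcave×unimodal (independencePolynomial Γ) 2≤w w≤v 2v≤3w s≗bumped
  where open PrimeCube p pr
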